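{- For any $k\geq 12$ and any admissible $v$ (that is, any $v$ such that a $(K_v,P_k)$-design exists), $$\left\{ n\geq v-\left\lfloor\frac{k-12}{4}\right\rfloor \;\Big|\; n\equiv 0,1\pmod 3\right\}\subseteq \mathcal{L}_2P_k(v)\subseteq\mathcal{L}_1P_k(v).$$
   Context: Graphs are finite and simple; $\Gamma'\leq\Gamma$ means that $\Gamma'$ is (isomorphic to) a subgraph of $\Gamma$. $K_n$ is the complete graph on $n$ vertices and $P_k$ is the path with $k$ vertices and $k-1$ edges. For graphs $\Gamma\leq K$, a $(K,\Gamma)$-design is a set of subgraphs of $K$, called blocks, each isomorphic to $\Gamma$, whose edge sets partition $E(K)$. A $(K_v,\Gamma)$-design is also called a $\Gamma$-design of order $v$. Given a $(K,\Gamma)$-design $\mathcal B$ and a $(K',\Gamma')$-design $\mathcal B'$ with $\Gamma'\leq\Gamma$, a down-link from $\mathcal B$ to $\mathcal B'$ is a function $f:\mathcal B\to\mathcal B'$ such that, for every $B\in\mathcal B$, $f(B)$ is a subgraph of $B$ (as an actual graph on the given vertices, not merely up to isomorphism). The complete graphs $K=K_v$ and $K'=K_n$ may have different vertex sets. When such an $f$ exists, $\mathcal B$ is said to be down-linked to $\mathcal B'$. Throughout, the target graph is $\Gamma'=P_4$. $\mathcal{L}_1\Gamma(v)$ is the set of all integers $n$ such that there exists some $\Gamma$-design of order $v$ that can be down-linked to some $P_4$-design of order $n$. $\mathcal{L}_2\Gamma(v)$ is the set of all integers $n$ such that every $\Gamma$-design of order $v$ can be down-linked to some $P_4$-design of order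 $n$. Here these are used with $\Gamma=P_k$. -}

module Defs where

open import Data.Fin using (Fin)
open import Data.List using (List; upTo)
open import Data.List.Membership.Propositional using (_∈_)
open import Data.List.Membership.Propositional.Properties using (∈-upTo⁺)
open import Data.Nat using (ℕ; suc; _<_; _<?_; _≟_)
open import Data.Nat.Properties using (1+n≢n)
open import Data.Product using (Σ; ∃!; ∃-syntax; _×_; _,_)
open import Data.Sum using (_⊎_; inj₁; inj₂; swap)
open import Function.Bundles using (_⇔_)
open import Level using (0ℓ) renaming (suc to lsuc)
open import Relation.Binary.Core using (Rel)
open import Relation.Binary.Definitions using (Decidable; Symmetric; Irreflexive)
open import Relation.Binary.PropositionalEquality using (_≡_; _≢_; refl; sym; ≢-sym)
open import Relation.Nullary.Decidable using (_×-dec_; _⊎-dec_; ¬?)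
open import Relation.Unary using (Pred)

-- Finite simple graphs.  All vertices are drawn from the common universe ℕ,
-- so that graphs on different vertex sets can be compared as actual graphs
-- and there are always fresh vertices.  The list `vertices` stands for the
-- finite set of its members: order and repetitions are irrelevant.
record Graph : Set₁ where
  field
    vertices   : List ℕ
    Adj        : Rel ℕ 0ℓ
    adj?       : Decidable Adj
    adj-sym    : Symmetric Adj
    adj-irrefl : Irreflexive _≡_ Adj
    adj-vertex : ∀ {x y} → Adj x y → x ∈ vertices

open Graph public

infix 4 _⊑_ _≈ᴳ_ _≅_ _≤ᴳ_

-- H ⊑ G: H is literally a subgraph (not necessarily induced) of G.
_⊑_ : Graph → Graph → Set
H ⊑ G = (∀ {x} → x ∈ vertices H → x ∈ vertices G)
      × (∀ {x y} → Adj H x y → Adj G x y)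

_≈ᴳ_ : Graph → Graph → Set
G ≈ᴳ H = G ⊑ H × H ⊑ G

-- Only the values of `to` and `from` on vertices matter.
record _≅_ (G H : Graph) : Set where
  field
    to        : ℕ → ℕ
    from      : ℕ → ℕ
    to-∈      : ∀ {x} → x ∈ vertices G → to x ∈ vertices H
    from-∈    : ∀ {y} → y ∈ vertices H → from y ∈ vertices G
    from∘to   : ∀ {x} → x ∈ vertices G → from (to x) ≡ x
    to∘from   : ∀ {y} → y ∈ vertices H → to (from y) ≡ y
    adj-⇔     : ∀ {x y} → x ∈ vertices G → y ∈ vertices G →
                Adj G x y ⇔ Adj H (to x) (to y)

_≤ᴳ_ : Graph → Graph → Set₁
Γ′ ≤ᴳ Γ = ∃[ H ] (H ⊑ Γ × H ≅ Γ′)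

K : ℕ → Graph
K n = record
  { vertices   = upTo n
  ; Adj        = λ x y → x < n × y < n × x ≢ y
  ; adj?       = λ x y → (x <? n) ×-dec ((y <? n) ×-dec ¬? (x ≟ y))
  ; adj-sym    = λ (x<n , y<n , x≢y) → y<n , x<n , ≢-sym x≢y
  ; adj-irrefl = λ x≡y (_ , _ , x≢y) → x≢y x≡y
  ; adj-vertex = λ (x<n , _) → ∈-upTo⁺ x<n
  }

-- The path 0 — 1 — ⋯ — (k-1), with k vertices.
P : ℕ → Graph
P k = record
  { vertices   = upTo k
  ; Adj        = λ x y → x < k × y < k × (y ≡ suc x ⊎ x ≡ suc y)
  ; adj?       = λ x y → (x <? k) ×-dec ((y <? k) ×-dec ((y ≟ suc x) ⊎-dec (x ≟ suc y)))
  ; adj-sym    = λ (x<k , y<k , e) → y<k , x<k , swap e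
  ; adj-irrefl = λ { refl (_ , _ , inj₁ e) → 1+n≢n (sym e)
                   ; refl (_ , _ , inj₂ e) → 1+n≢n (sym e) }
  ; adj-vertex = λ (x<k , _) → ∈-upTo⁺ x<k
  }

-- (G , Γ)-designs.  The set of blocks is enumerated without repetition by
-- Fin size.
record Design (G Γ : Graph) : Set₁ where
  field
    Γ≤G       : Γ ≤ᴳ G
    size      : ℕ
    block     : Fin size → Graph
    distinct  : ∀ {i j} → block i ≈ᴳ block j → i ≡ j
    block⊑G   : ∀ i → block i ⊑ G
    block≅Γ   : ∀ i → block i ≅ Γ
    partition : ∀ {x y} → Adj G x y → ∃! _≡_ (λ i → Adj (block i) x y)

-- The host may be any complete graph on v vertices, not only the one on
-- {0, …, v-1}.
record DesignOfOrder (Γ : Graph) (v : ℕ) : Set₁ where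
  field
    host     : Graph
    host≅K   : host ≅ K v
    design   : Design host Γ
  open Design design public

record DownLink {G Γ G′ Γ′ : Graph} (B : Design G Γ) (B′ : Design G′ Γ′) : Set₁ where
  private
    module B  = Design B
    module B′ = Design B′
  field
    Γ′≤Γ     : Γ′ ≤ᴳ Γ
    f        : Fin B.size → Fin B′.size
    subgraph : ∀ i → B′.block (f i) ⊑ B.block i

Admissible : Graph → ℕ → Set₁
Admissible Γ v = DesignOfOrder Γ v

DownLinkedTo : ∀ {Γ v n} → DesignOfOrder Γ v → DesignOfOrder (P 4) n → Set₁
DownLinkedTo B B′ = DownLink (DesignOfOrder.design B) (DesignOfOrder.design B′)

-- Spectra of orders of the P₄-designs to which some (ℒ₁), respectively every
-- (ℒ₂), Γ-design of order v can be down-linked.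
ℒ₁ : Graph → ℕ → Pred ℕ (lsuc 0ℓ)
ℒ₁ Γ v n = Σ (DesignOfOrder Γ v) λ B →
           Σ (DesignOfOrder (P 4) n) λ B′ → DownLinkedTo B B′

ℒ₂ : Graph → ℕ → Pred ℕ (lsuc 0ℓ)
ℒ₂ Γ v n = (B : DesignOfOrder Γ v) →
           Σ (DesignOfOrder (P 4) n) λ B′ → DownLinkedTo B B′

{-# OPTIONS --safe #-}

-- Write s = ⌊(k-12)/4⌋ and n = m + 2, and identify the vertices of K_n with an
-- initial segment of those of K_v (extended by new vertices when n > v).  A path
-- with k ≥ 4(s + 3) vertices contains s + 3 vertex-disjoint copies of P₄, and at
-- most s + 2 vertices of K_v lie outside the first m; so every block contains a
-- P₄ on the first m vertices, and these P₄'s are pairwise edge-disjoint.  The two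
-- remaining vertices u, w of K_n are still joined to everything, which makes it
-- possible to decompose all remaining edges.
--
-- First, insert the remaining edges of K_m one at a time, splitting off P₄'s, so
-- that what is left always has an orientation with all indegrees at most 1.  Then
-- absorb the arcs with the help of u and w: the first arc x → y gives the path
-- x y u w and leaves the edge yw.  An arc t → h and an edge yw left over from the
-- previous arc give the path t h w y and leave the edge hu; if t = y, a vertex a
-- which is not the head of any arc gives the path h y w a instead and leaves the
-- edge au.  Each arc uses up both edges from one vertex to {u, w}.  Counting edges
-- mod 3, the number of vertices never used is 1 mod 3, so one of them closes the
-- last edge yw to a path y w a u, and the others, three at a time, give
-- K_{2,3} = 2 P₄.
module Submission where

open import Defs
import Algebra.Solver.CommutativeMonoid as CommutativeMonoidSolver
open import Data.Fin as Fin using (Fin; toℕ; fromℕ<; combine)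
import Data.Fin.Properties as Fin
open import Data.List using (List; []; _∷_; _++_; map; concatMap; length; lookup; tabulate; downFrom)
open import Data.List.Extrema.Nat using (max; xs≤max)
import Data.List.Membership.DecPropositional as DecMembership
open import Data.List.Membership.Propositional using (_∈_; _∉_; find)
open import Data.List.Membership.Propositional.Properties
open import Data.List.Properties
  using (length-++; length-map; length-downFrom; concatMap-++; map-++; map-cong)
open import Data.List.Relation.Binary.Permutation.Propositional
  using (_↭_; ↭-refl; ↭-sym; ↭-trans; ↭-reflexive; prep; module PermutationReasoning; ↭⇒↭ₛ)
open import Data.List.Relation.Binary.Permutation.Propositional.Properties
  using (All-resp-↭; ∈-resp-↭; ↭-length; map⁺; ++⁺; ++⁺ˡ; ++⁺ʳ; shift; ++-commutativeMonoid)
import Data.List.Relation.Binary.Permutation.Setoid.Properties as PermSetoid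
open import Data.List.Relation.Unary.All as All using (All; []; _∷_)
import Data.List.Relation.Unary.All.Properties as All
open import Data.List.Relation.Unary.AllPairs using ([]; _∷_)
import Data.List.Relation.Unary.AllPairs.Properties as AllPairs
open import Data.List.Relation.Unary.Any as Any using (here; there)
open import Data.List.Relation.Unary.Any.Properties using (lookup-index)
open import Data.List.Relation.Unary.Unique.Propositional using (Unique)
import Data.List.Relation.Unary.Unique.Propositional.Properties as Unique
open import Data.Nat
open import Data.Nat.DivMod using ([m+kn]%n≡m%n; m/n*n≤m)
open import Data.Nat.Properties
open import Data.Nat.Solver using (module +-*-Solver)
open import Data.Product using (_×_; _,_; proj₁; proj₂; ∃-syntax; Σ; Σ-syntax; uncurry)
open import Data.Product.Properties using (≡-dec)
open import Data.Sum using (_⊎_; inj₁; inj₂)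
open import Function using (_∘_; id; mk⇔; Equivalence)
open import Relation.Binary.Definitions using (tri<; tri≈; tri>)
open import Relation.Binary.PropositionalEquality
  using (_≡_; _≢_; refl; sym; trans; cong; cong₂; subst; subst₂; ≢-sym; setoid; module ≡-Reasoning)
open import Relation.Nullary using (¬_; yes; no; contradiction)
open import Relation.Nullary.Decidable using (_×-dec_; ¬?)
open import Relation.Unary using (_⊆_)
open DecMembership _≟_ using (_∈?_)
open DecMembership (≡-dec _≟_ _≟_) using () renaming (_∈?_ to _∈ᴱ?_)

-- Lists without repetition, up to permutation

Unique-resp-↭ : ∀ {A : Set} {xs ys : List A} → xs ↭ ys → Unique xs → Unique ys
Unique-resp-↭ {A} p = PermSetoid.Unique-resp-↭ (setoid A) (↭⇒↭ₛ p)

Unique-++⁻ʳ : ∀ {A : Set} (xs : List A) {ys} → Unique (xs ++ ys) → Unique ys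
Unique-++⁻ʳ []       u       = u
Unique-++⁻ʳ (x ∷ xs) (_ ∷ u) = Unique-++⁻ʳ xs u

∈⇒↭ : ∀ {A : Set} {x : A} {xs} → x ∈ xs → ∃[ rest ] xs ↭ x ∷ rest
∈⇒↭ x∈xs with ys , zs , refl ← ∈-∃++ x∈xs = ys ++ zs , shift _ ys zs

-- Takes the entries of `ps` out of `xs` one at a time; since `ps` has no repetitions, the later
-- entries survive each removal. This serves as set difference for edges and for vertices.
Unique-⊆⇒↭ : ∀ {A : Set} (ps : List A) {xs} → Unique ps → (∀ {x} → x ∈ ps → x ∈ xs) →
             ∃[ rest ] xs ↭ ps ++ rest
Unique-⊆⇒↭ []       _          _    = _ , ↭-refl
Unique-⊆⇒↭ (p ∷ ps) (p∉ ∷ ups) ps⊆ with ∈⇒↭ (ps⊆ (here refl))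
... | xs′ , perm with Unique-⊆⇒↭ ps ups ps⊆xs′
  where
  ps⊆xs′ : ∀ {x} → x ∈ ps → x ∈ xs′
  ps⊆xs′ x∈ with ∈-resp-↭ perm (ps⊆ (there x∈))
  ... | here refl = contradiction refl (All.lookup p∉ x∈)
  ... | there x∈′ = x∈′
... | rest , perm′ = rest , ↭-trans perm (prep p perm′)

-- Edges and paths with four vertices

Edge : Set
Edge = ℕ × ℕ

-- An undirected edge is represented by its sorted pair of ends, so that
-- decompositions become permutations of lists; edge x x is a junk value.
opaque
  edge : ℕ → ℕ → Edge
  edge x y = x ⊓ y , x ⊔ y

  edge-comm : ∀ x y → edge x y ≡ edge y x
  edge-comm x y = cong₂ _,_ (⊓-comm x y) (⊔-comm x y)

  edge-refl : ∀ x → edge x x ≡ (x , x)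
  edge-refl x = cong₂ _,_ (⊓-idem x) (⊔-idem x)

  edge-< : ∀ {x y} → x < y → edge x y ≡ (x , y)
  edge-< x<y = cong₂ _,_ (m≤n⇒m⊓n≡m (<⇒≤ x<y)) (m≤n⇒m⊔n≡n (<⇒≤ x<y))

edge-> : ∀ {x y} → y < x → edge x y ≡ (y , x)
edge-> {x} {y} y<x = trans (edge-comm x y) (edge-< y<x)

edge-split : ∀ x y → x ≢ y → (x < y × edge x y ≡ (x , y)) ⊎ (y < x × edge x y ≡ (y , x))
edge-split x y x≢y with <-cmp x y
... | tri< x<y _ _ = inj₁ (x<y , edge-< x<y)
... | tri≈ _ x≡y _ = contradiction x≡y x≢y
... | tri> _ _ y<x = inj₂ (y<x , edge-> y<x)

edge-ordered : ∀ {x y} → x ≢ y → uncurry _<_ (edge x y)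
edge-ordered {x} {y} x≢y with edge-split x y x≢y
... | inj₁ (x<y , eq) rewrite eq = x<y
... | inj₂ (y<x , eq) rewrite eq = y<x

edge-injective : ∀ {a b c d} → c ≢ d → edge a b ≡ edge c d →
                 (a ≡ c × b ≡ d) ⊎ (a ≡ d × b ≡ c)
edge-injective {a} {b} {c} {d} c≢d eq with a ≟ b
-- If a = b, the left side is a diagonal pair, whereas `c ≢ d` makes the right side strictly
-- increasing.
... | yes refl = contradiction (subst (uncurry _<_) (trans (sym eq) (edge-refl a)) (edge-ordered c≢d)) (<-irrefl refl)
... | no a≢b with edge-split a b a≢b | edge-split c d c≢d
... | inj₁ (_ , p) | inj₁ (_ , q) with refl ← trans (sym p) (trans eq q) = inj₁ (refl , refl)
... | inj₁ (_ , p) | inj₂ (_ , q) with refl ← trans (sym p) (trans eq q) = inj₂ (refl , refl)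
... | inj₂ (_ , p) | inj₁ (_ , q) with refl ← trans (sym p) (trans eq q) = inj₂ (refl , refl)
... | inj₂ (_ , p) | inj₂ (_ , q) with refl ← trans (sym p) (trans eq q) = inj₁ (refl , refl)

allEdges : List ℕ → List Edge
allEdges []       = []
allEdges (x ∷ xs) = map (edge x) xs ++ allEdges xs

∈-allEdges⁺ : ∀ {xs x y} → x ∈ xs → y ∈ xs → x ≢ y → edge x y ∈ allEdges xs
∈-allEdges⁺ (here refl) (here refl) x≢y = contradiction refl x≢y
∈-allEdges⁺ (here refl) (there y∈)  x≢y = ∈-++⁺ˡ (∈-map⁺ (edge _) y∈)
∈-allEdges⁺ {x = x} {y} (there x∈) (here refl) x≢y
  rewrite edge-comm x y = ∈-++⁺ˡ (∈-map⁺ (edge _) x∈)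
∈-allEdges⁺ {z ∷ xs} (there x∈) (there y∈) x≢y = ∈-++⁺ʳ (map (edge z) xs) (∈-allEdges⁺ x∈ y∈ x≢y)

∈-allEdges⁻ : ∀ {xs e} → Unique xs → e ∈ allEdges xs →
              ∃[ x ] ∃[ y ] (x ∈ xs × y ∈ xs × x ≢ y × e ≡ edge x y)
∈-allEdges⁻ {z ∷ xs} (z∉ ∷ uxs) e∈ with ∈-++⁻ (map (edge z) xs) e∈
... | inj₁ e∈₁ with y , y∈ , eq ← ∈-map⁻ (edge z) e∈₁ =
  z , y , here refl , there y∈ , All.lookup z∉ y∈ , eq
... | inj₂ e∈₂ with x , y , x∈ , y∈ , x≢y , eq ← ∈-allEdges⁻ uxs e∈₂ =
  x , y , there x∈ , there y∈ , x≢y , eq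

∈-allEdges⇒∈ : ∀ {xs x y} → Unique xs → edge x y ∈ allEdges xs → x ∈ xs × y ∈ xs
∈-allEdges⇒∈ uxs e∈ with a , b , a∈ , b∈ , a≢b , eq ← ∈-allEdges⁻ uxs e∈
  with edge-injective a≢b eq
... | inj₁ (refl , refl) = a∈ , b∈
... | inj₂ (refl , refl) = b∈ , a∈

allEdges-ordered : ∀ {xs e} → Unique xs → e ∈ allEdges xs → uncurry _<_ e
allEdges-ordered uxs e∈ with _ , _ , _ , _ , x≢y , refl ← ∈-allEdges⁻ uxs e∈ = edge-ordered x≢y

allEdges-unique : ∀ {xs} → Unique xs → Unique (allEdges xs)
allEdges-unique {[]}     []         = []
allEdges-unique {z ∷ xs} (z∉ ∷ uxs) =
  Unique.++⁺ (map-edge xs z∉ uxs) (allEdges-unique uxs) disjoint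
  where
  map-edge : ∀ ys → All (z ≢_) ys → Unique ys → Unique (map (edge z) ys)
  map-edge []       []         []         = []
  map-edge (y ∷ ys) (z≢y ∷ z∉) (y∉ ∷ uys) = All.tabulate fresh ∷ map-edge ys z∉ uys
    where
    fresh : ∀ {e} → e ∈ map (edge z) ys → edge z y ≢ e
    fresh e∈ eq with y′ , y′∈ , refl ← ∈-map⁻ (edge z) e∈
      with edge-injective (All.lookup z∉ y′∈) eq
    ... | inj₁ (_ , refl) = All.lookup y∉ y′∈ refl
    ... | inj₂ (_ , refl) = z≢y refl
  disjoint : ∀ {e} → ¬ (e ∈ map (edge z) xs × e ∈ allEdges xs)
  disjoint (e∈₁ , e∈₂) with y , y∈ , refl ← ∈-map⁻ (edge z) e∈₁ =
    All.lookup z∉ (proj₁ (∈-allEdges⇒∈ uxs e∈₂)) refl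

record Path₄ : Set where
  constructor path
  field
    p₀ p₁ p₂ p₃ : ℕ
    uniq        : Unique (p₀ ∷ p₁ ∷ p₂ ∷ p₃ ∷ [])

open Path₄ public

edges : Path₄ → List Edge
edges p = edge (p₀ p) (p₁ p) ∷ edge (p₁ p) (p₂ p) ∷ edge (p₂ p) (p₃ p) ∷ []

mkPath : ∀ a b c d → a ≢ b → a ≢ c → a ≢ d → b ≢ c → b ≢ d → c ≢ d → Path₄
mkPath a b c d ab ac ad bc bd cd =
  path a b c d ((ab ∷ ac ∷ ad ∷ []) ∷ (bc ∷ bd ∷ []) ∷ (cd ∷ []) ∷ [] ∷ [])

edgesOf : List Path₄ → List Edge
edgesOf = concatMap edges

edgesOf-++ : ∀ D D′ → edgesOf (D ++ D′) ≡ edgesOf D ++ edgesOf D′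
edgesOf-++ = concatMap-++ edges

length-edgesOf : ∀ D → length (edgesOf D) ≡ length D * 3
length-edgesOf []      = refl
length-edgesOf (_ ∷ D) = cong (3 +_) (length-edgesOf D)

Decomposable : List Edge → Set
Decomposable E = ∃[ D ] E ↭ edgesOf D

infixr 5 _▸_by_
-- In a chain of paths the last `by` belongs to the first path. With ↭-refl in the inner places, a
-- single rearrangement exhibits all the paths at once.
_▸_by_ : ∀ {E E′} (p : Path₄) → Decomposable E′ → E ↭ edges p ++ E′ → Decomposable E
p ▸ (D , perm′) by perm = p ∷ D , ↭-trans perm (++⁺ˡ (edges p) perm′)

module E = CommutativeMonoidSolver (++-commutativeMonoid {A = Edge})

-- Reducing an edge set to arcs with distinct heads

Arc : Set
Arc = ℕ × ℕ

arcEdge : Arc → Edge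
arcEdge (t , h) = edge t h

arcEdges : List Arc → List Edge
arcEdges = map arcEdge

heads : List Arc → List ℕ
heads = map proj₂

-- The field `heads-!` is the indegree condition; tails may repeat. As the heads are distinct
-- vertices, each arc can later be paid for by the two apex edges of a vertex of its own.
record Reduction (E : List Edge) (D : List Path₄) (arcs : List Arc) : Set where
  field
    perm     : E ↭ arcEdges arcs ++ edgesOf D
    heads-!  : Unique (heads arcs)
    loopless : All (uncurry _≢_) arcs

open Reduction

reorder : ∀ {E D arcs arcs′} → arcs ↭ arcs′ → Reduction E D arcs → Reduction E D arcs′
reorder {D = D} σ r = record
  { perm     = ↭-trans (perm r) (++⁺ʳ (edgesOf D) (map⁺ arcEdge σ))
  ; heads-!  = Unique-resp-↭ (map⁺ proj₂ σ) (heads-! r)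
  ; loopless = All-resp-↭ σ (loopless r)
  }

inArc : ∀ x arcs → x ∉ heads arcs ⊎ ∃[ t ] ∃[ rest ] arcs ↭ (t , x) ∷ rest
inArc x arcs with x ∈? heads arcs
... | no  x∉ = inj₁ x∉
... | yes x∈ with (t , _) , a∈ , refl ← ∈-map⁻ proj₂ x∈ = inj₂ (t , ∈⇒↭ a∈)

Reduced : List Edge → Set
Reduced E = ∃[ D ] ∃[ arcs ] Reduction E D arcs

-- If a and b both have in-arcs a′ → a and b′ → b, then a′ a b b′ is a P₄ unless
-- a′ = b′.  In that case either c → a′ exists, and c a′ a b is a P₄, or the
-- triangle can be oriented cyclically.
insert : ∀ {E} a b → a ≢ b → Unique (edge a b ∷ E) → Reduced E → Reduced (edge a b ∷ E)
insert {E} a b a≢b uE (D , arcs , r) with inArc a arcs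
... | inj₁ a∉ = D , (b , a) ∷ arcs , record
  { perm     = ↭-trans (prep _ (perm r)) (↭-reflexive (cong (_∷ _) (edge-comm a b)))
  ; heads-!  = All.¬Any⇒All¬ _ a∉ ∷ heads-! r
  ; loopless = ≢-sym a≢b ∷ loopless r
  }
... | inj₂ (a′ , arcs₁ , σ) with inArc b arcs₁
... | inj₁ b∉ = D , (a , b) ∷ (a′ , a) ∷ arcs₁ , record
  { perm     = prep _ (perm r₁)
  ; heads-!  = (≢-sym a≢b ∷ All.¬Any⇒All¬ _ b∉) ∷ heads-! r₁
  ; loopless = a≢b ∷ loopless r₁
  }
  where r₁ = reorder σ r
... | inj₂ (b′ , arcs₂ , τ) = resolve (reorder (↭-trans σ (prep _ τ)) r)
  where
  resolve : Reduction E D ((a′ , a) ∷ (b′ , b) ∷ arcs₂) → Reduced (edge a b ∷ E)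
  resolve r with Unique-resp-↭ (prep _ (perm r)) uE | heads-! r | loopless r
  -- The vertices of the intended path are distinct because most coincidences would make two entries
  -- of a repetition-free edge list equal; the coincidence a′ = b′ is the one left to decide.
  ... | (ab≢a′a ∷ ab≢b′b ∷ _) ∷ _ ∷ _ | (_ ∷ a∉) ∷ b∉ ∷ u | a′≢a ∷ b′≢b ∷ ll with a′ ≟ b′
  ... | no a′≢b′ = mkPath a′ a b b′ a′≢a a′≢b a′≢b′ a≢b (≢-sym b′≢a) (≢-sym b′≢b) ∷ D , arcs₂ , record
    { perm     = ↭-trans (prep _ (perm r)) rearrange
    ; heads-!  = u
    ; loopless = ll
    }
    where
    a′≢b : a′ ≢ b
    a′≢b refl = ab≢a′a (edge-comm a b)
    b′≢a : b′ ≢ a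
    b′≢a refl = ab≢b′b refl
    rearrange : edge a b ∷ edge a′ a ∷ edge b′ b ∷ arcEdges arcs₂ ++ edgesOf D ↭
                arcEdges arcs₂ ++ edge a′ a ∷ edge a b ∷ edge b b′ ∷ edgesOf D
    rearrange rewrite edge-comm b b′ =
      solve 5 (λ x y z r d → x ⊕ y ⊕ z ⊕ r ⊕ d ⊜ r ⊕ y ⊕ x ⊕ z ⊕ d) ↭-refl
        (edge a b ∷ []) (edge a′ a ∷ []) (edge b′ b ∷ []) (arcEdges arcs₂) (edgesOf D)
      where open E
  ... | yes refl with inArc a′ arcs₂
  ... | inj₁ c∉ = D , (b , a) ∷ (a′ , b) ∷ (a , a′) ∷ arcs₂ , record
    { perm     = ↭-trans (prep _ (perm r)) rearrange
    ; heads-!  = (a≢b ∷ ≢-sym a′≢a ∷ a∉) ∷ (≢-sym b′≢b ∷ b∉) ∷ All.¬Any⇒All¬ _ c∉ ∷ u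
    ; loopless = ≢-sym a≢b ∷ b′≢b ∷ ≢-sym a′≢a ∷ ll
    }
    where
    rearrange : edge a b ∷ edge a′ a ∷ edge a′ b ∷ arcEdges arcs₂ ++ edgesOf D ↭
                edge b a ∷ edge a′ b ∷ edge a a′ ∷ arcEdges arcs₂ ++ edgesOf D
    rearrange rewrite edge-comm b a | edge-comm a a′ =
      solve 4 (λ x y z r → x ⊕ y ⊕ z ⊕ r ⊜ x ⊕ z ⊕ y ⊕ r) ↭-refl
        (edge a b ∷ []) (edge a′ a ∷ []) (edge a′ b ∷ []) (arcEdges arcs₂ ++ edgesOf D)
      where open E
  ... | inj₂ (c′ , arcs₃ , υ) = extract (reorder (prep _ (prep _ υ)) r)
    where
    extract : Reduction E D ((a′ , a) ∷ (a′ , b) ∷ (c′ , a′) ∷ arcs₃) → Reduced (edge a b ∷ E)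
    extract r with Unique-resp-↭ (prep _ (perm r)) uE | heads-! r | loopless r
    ... | _ ∷ (_ ∷ ca≢c′c ∷ _) ∷ (cb≢c′c ∷ _) ∷ _ | _ ∷ (_ ∷ b∉) ∷ _ ∷ u | _ ∷ _ ∷ c′≢c ∷ ll =
      mkPath c′ a′ a b c′≢c c′≢a c′≢b a′≢a b′≢b a≢b ∷ D , (a′ , b) ∷ arcs₃ , record
      { perm     = ↭-trans (prep _ (perm r)) rearrange
      ; heads-!  = b∉ ∷ u
      ; loopless = b′≢b ∷ ll
      }
      where
      c′≢a : c′ ≢ a
      c′≢a refl = ca≢c′c (edge-comm a′ a)
      c′≢b : c′ ≢ b
      c′≢b refl = cb≢c′c (edge-comm a′ b)
      rearrange : edge a b ∷ edge a′ a ∷ edge a′ b ∷ edge c′ a′ ∷ arcEdges arcs₃ ++ edgesOf D ↭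
                  edge a′ b ∷ arcEdges arcs₃ ++ edge c′ a′ ∷ edge a′ a ∷ edge a b ∷ edgesOf D
      rearrange =
        solve 6 (λ x y z t r d → x ⊕ y ⊕ z ⊕ t ⊕ r ⊕ d ⊜ z ⊕ r ⊕ t ⊕ y ⊕ x ⊕ d) ↭-refl
          (edge a b ∷ []) (edge a′ a ∷ []) (edge a′ b ∷ []) (edge c′ a′ ∷ [])
          (arcEdges arcs₃) (edgesOf D)
        where open E

reduce : ∀ E → All (uncurry _<_) E → Unique E → Reduced E
reduce []            []        []         = [] , [] , record { perm = ↭-refl ; heads-! = [] ; loopless = [] }
reduce ((x , y) ∷ E) (x<y ∷ o) uE@(_ ∷ u) =
  -- An increasing pair is its own normal form, so `insert` applies to it.
  subst (λ e → Reduced (e ∷ E)) (edge-< x<y)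
    (insert x y (<⇒≢ x<y) (subst (λ e → Unique (e ∷ E)) (sym (edge-< x<y)) uE) (reduce E o u))

-- Absorbing the arcs by two apex vertices

star : ℕ → List ℕ → List Edge
star c = map (λ x → edge x c)

-- The six edges from a, b, c to the apices form the two paths a u b w and a w c u.
spokes-decomposable : ∀ {u w} F → Unique (u ∷ w ∷ F) → length F % 3 ≡ 0 →
                      Decomposable (star u F ++ star w F)
spokes-decomposable []      _ _ = [] , ↭-refl
spokes-decomposable {u} {w} (a ∷ b ∷ c ∷ F)
  ((u≢w ∷ u≢a ∷ u≢b ∷ u≢c ∷ u∉) ∷ (w≢a ∷ w≢b ∷ w≢c ∷ w∉) ∷ (a≢b ∷ a≢c ∷ _) ∷ (b≢c ∷ _) ∷ _ ∷ uF) l =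
  mkPath a u b w (≢-sym u≢a) a≢b (≢-sym w≢a) u≢b u≢w (≢-sym w≢b) ▸
  mkPath a w c u (≢-sym w≢a) a≢c (≢-sym u≢a) w≢c (≢-sym u≢w) (≢-sym u≢c) ▸
  spokes-decomposable F ((u≢w ∷ u∉) ∷ w∉ ∷ uF) l
  by ↭-refl by rearrange
  where
  rearrange : star u (a ∷ b ∷ c ∷ F) ++ star w (a ∷ b ∷ c ∷ F) ↭
              edge a u ∷ edge u b ∷ edge b w ∷ edge a w ∷ edge w c ∷ edge c u ∷ star u F ++ star w F
  rearrange rewrite edge-comm u b | edge-comm w c =
    solve 8 (λ au bu cu aw bw cw U W →
        au ⊕ bu ⊕ cu ⊕ U ⊕ aw ⊕ bw ⊕ cw ⊕ W ⊜ au ⊕ bu ⊕ bw ⊕ aw ⊕ cw ⊕ cu ⊕ U ⊕ W) ↭-refl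
      (edge a u ∷ []) (edge b u ∷ []) (edge c u ∷ []) (edge a w ∷ []) (edge b w ∷ []) (edge c w ∷ [])
      (star u F) (star w F)
    where open E

pred-mod-3 : ∀ n → suc n % 3 ≡ 1 → n % 3 ≡ 0
pred-mod-3 0                   _  = refl
pred-mod-3 (suc (suc (suc n))) eq = pred-mod-3 n eq

-- The stars are split in two because the vertices play two roles: heads, which leave together with
-- their arcs, and free vertices F, which form the reserve for the exceptional case and for the end.
unattached : ℕ → ℕ → List Arc → List ℕ → List Edge
unattached u w arcs F = arcEdges arcs ++ star u (heads arcs) ++ star w (heads arcs) ++ star u F ++ star w F

Off : ℕ → ℕ → Arc → Set
Off u w (t , h) = t ≢ u × t ≢ w × t ≢ h

-- Induction on the arcs, with u and w exchanging roles at each step because the next pending edge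
-- ends in the other apex. The vertex y has already spent its other apex edge, so it lies outside
-- `heads arcs ++ F`. The length of F never changes during the recursion, and being 1 mod 3 it
-- guarantees a free vertex whenever one is called for.
absorb : ∀ u w y arcs F → Unique (u ∷ w ∷ y ∷ heads arcs ++ F) → All (Off u w) arcs →
         length F % 3 ≡ 1 → Decomposable (edge y w ∷ unattached u w arcs F)
absorb u w y [] (a ∷ F) ((u≢w ∷ u≢y ∷ u≢a ∷ u∉) ∷ (w≢y ∷ w≢a ∷ w∉) ∷ (y≢a ∷ _) ∷ _ ∷ uF) [] l =
  mkPath y w a u (≢-sym w≢y) y≢a (≢-sym u≢y) w≢a (≢-sym u≢w) (≢-sym u≢a) ▸
  spokes-decomposable F ((u≢w ∷ u∉) ∷ w∉ ∷ uF) (pred-mod-3 (length F) l)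
  by rearrange
  where
  rearrange : edge y w ∷ unattached u w [] (a ∷ F) ↭
              edge y w ∷ edge w a ∷ edge a u ∷ star u F ++ star w F
  rearrange rewrite edge-comm w a =
    solve 5 (λ yw au aw U W → yw ⊕ au ⊕ U ⊕ aw ⊕ W ⊜ yw ⊕ aw ⊕ au ⊕ U ⊕ W) ↭-refl
      (edge y w ∷ []) (edge a u ∷ []) (edge a w ∷ []) (star u F) (star w F)
    where open E
absorb u w y ((t , h) ∷ arcs) F uniq ((t≢u , t≢w , t≢h) ∷ off) l with t ≟ y
... | no t≢y with uniq
... | (u≢w ∷ u≢y ∷ u≢h ∷ u∉) ∷ (w≢y ∷ w≢h ∷ w∉) ∷ (y≢h ∷ _) ∷ uh =
  mkPath t h w y t≢h t≢w t≢y (≢-sym w≢h) (≢-sym y≢h) w≢y ▸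
  -- The edge hw has been spent and hu is pending, so h takes the place of y.
  absorb w u h arcs F ((≢-sym u≢w ∷ w≢h ∷ w∉) ∷ (u≢h ∷ u∉) ∷ uh)
    (All.map (λ (p , q , r) → q , p , r) off) l
  by rearrange
  where
  rearrange : edge y w ∷ unattached u w ((t , h) ∷ arcs) F ↭
              edge t h ∷ edge h w ∷ edge w y ∷ edge h u ∷ unattached w u arcs F
  rearrange rewrite edge-comm w y =
    solve 9 (λ yw th hu hw A UH WH U W →
        yw ⊕ th ⊕ A ⊕ (hu ⊕ UH) ⊕ (hw ⊕ WH) ⊕ U ⊕ W ⊜ th ⊕ hw ⊕ yw ⊕ hu ⊕ A ⊕ WH ⊕ UH ⊕ W ⊕ U) ↭-refl
      (edge y w ∷ []) (edge t h ∷ []) (edge h u ∷ []) (edge h w ∷ [])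
      (arcEdges arcs) (star u (heads arcs)) (star w (heads arcs)) (star u F) (star w F)
    where open E
absorb u w y ((t , h) ∷ arcs) (a ∷ F) uniq ((t≢u , t≢w , t≢h) ∷ off) l | yes refl
  with Unique-resp-↭ (prep u (prep w (prep t (prep h (shift a (heads arcs) F))))) uniq
... | (u≢w ∷ u≢t ∷ u≢h ∷ u≢a ∷ u∉) ∷ (w≢t ∷ w≢h ∷ w≢a ∷ w∉) ∷ (_ ∷ t≢a ∷ _) ∷ (h≢a ∷ h∉) ∷ a∉ ∷ uF =
  mkPath h t w a (≢-sym t≢h) (≢-sym w≢h) h≢a t≢w t≢a w≢a ▸
  -- Both apex edges of h are still unspent, so h replaces a among the free vertices.
  absorb w u a arcs (h ∷ F)
    (Unique-resp-↭ (prep w (prep u (prep a (↭-sym (shift h (heads arcs) F)))))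
      ((≢-sym u≢w ∷ w≢a ∷ w≢h ∷ w∉) ∷ (u≢a ∷ u≢h ∷ u∉) ∷ (≢-sym h≢a ∷ a∉) ∷ h∉ ∷ uF))
    (All.map (λ (p , q , r) → q , p , r) off) l
  by rearrange
  where
  rearrange : edge t w ∷ unattached u w ((t , h) ∷ arcs) (a ∷ F) ↭
              edge h t ∷ edge t w ∷ edge w a ∷ edge a u ∷ unattached w u arcs (h ∷ F)
  rearrange rewrite edge-comm h t | edge-comm w a =
    solve 11 (λ tw th hu hw au aw A UH WH U W →
        tw ⊕ th ⊕ A ⊕ (hu ⊕ UH) ⊕ (hw ⊕ WH) ⊕ (au ⊕ U) ⊕ (aw ⊕ W) ⊜
        th ⊕ tw ⊕ aw ⊕ au ⊕ A ⊕ WH ⊕ UH ⊕ (hw ⊕ W) ⊕ hu ⊕ U) ↭-refl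
      (edge t w ∷ []) (edge t h ∷ []) (edge h u ∷ []) (edge h w ∷ []) (edge a u ∷ []) (edge a w ∷ [])
      (arcEdges arcs) (star u (heads arcs)) (star w (heads arcs)) (star u F) (star w F)
    where open E

-- The first arc consumes uw and leaves a pending edge for `absorb`. If there is no arc, uw and the
-- eight apex edges of four free vertices make up three paths.
join-decomposable : ∀ u w arcs F → Unique (u ∷ w ∷ heads arcs ++ F) → All (Off u w) arcs →
                    length F % 3 ≡ 1 → 4 ≤ length (heads arcs ++ F) →
                    Decomposable (edge u w ∷ unattached u w arcs F)
join-decomposable u w ((t , h) ∷ arcs) F
  ((u≢w ∷ u≢h ∷ u∉) ∷ (w≢h ∷ w∉) ∷ uh) ((t≢u , t≢w , t≢h) ∷ off) l _ =
  mkPath t h u w t≢h t≢u t≢w (≢-sym u≢h) (≢-sym w≢h) u≢w ▸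
  absorb u w h arcs F ((u≢w ∷ u≢h ∷ u∉) ∷ (w≢h ∷ w∉) ∷ uh) off l
  by rearrange
  where
  rearrange : edge u w ∷ unattached u w ((t , h) ∷ arcs) F ↭
              edge t h ∷ edge h u ∷ edge u w ∷ edge h w ∷ unattached u w arcs F
  rearrange =
    solve 8 (λ uw th hu hw A UH WH R →
        uw ⊕ th ⊕ A ⊕ (hu ⊕ UH) ⊕ (hw ⊕ WH) ⊕ R ⊜ th ⊕ hu ⊕ uw ⊕ hw ⊕ A ⊕ UH ⊕ WH ⊕ R) ↭-refl
      (edge u w ∷ []) (edge t h ∷ []) (edge h u ∷ []) (edge h w ∷ [])
      (arcEdges arcs) (star u (heads arcs)) (star w (heads arcs)) (star u F ++ star w F)
    where open E
-- Here the edges would form a triangle, which is not a path; the bound 4 excludes this case.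
join-decomposable u w [] (a ∷ [])             _ _ _ (s≤s ())
join-decomposable u w [] (a ∷ b ∷ c ∷ d ∷ F)
  ((u≢w ∷ u≢a ∷ u≢b ∷ u≢c ∷ u≢d ∷ u∉) ∷ (w≢a ∷ w≢b ∷ w≢c ∷ w≢d ∷ w∉) ∷
   (a≢b ∷ a≢c ∷ _) ∷ (_ ∷ b≢d ∷ _) ∷ _ ∷ _ ∷ uF) _ l _ =
  mkPath a u w b (≢-sym u≢a) (≢-sym w≢a) a≢b u≢w u≢b w≢b ▸
  mkPath a w c u (≢-sym w≢a) a≢c (≢-sym u≢a) w≢c (≢-sym u≢w) (≢-sym u≢c) ▸
  mkPath b u d w (≢-sym u≢b) b≢d (≢-sym w≢b) u≢d u≢w (≢-sym w≢d) ▸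
  spokes-decomposable F ((u≢w ∷ u∉) ∷ w∉ ∷ uF) (pred-mod-3 (length F) l)
  by ↭-refl by ↭-refl by rearrange
  where
  rearrange : edge u w ∷ unattached u w [] (a ∷ b ∷ c ∷ d ∷ F) ↭
              edge a u ∷ edge u w ∷ edge w b ∷ edge a w ∷ edge w c ∷ edge c u ∷
              edge b u ∷ edge u d ∷ edge d w ∷ star u F ++ star w F
  rearrange rewrite edge-comm w b | edge-comm w c | edge-comm u d =
    solve 11 (λ uw au bu cu du aw bw cw dw U W →
        uw ⊕ (au ⊕ bu ⊕ cu ⊕ du ⊕ U) ⊕ aw ⊕ bw ⊕ cw ⊕ dw ⊕ W ⊜
        au ⊕ uw ⊕ bw ⊕ aw ⊕ cw ⊕ cu ⊕ bu ⊕ du ⊕ dw ⊕ U ⊕ W) ↭-refl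
      (edge u w ∷ []) (edge a u ∷ []) (edge b u ∷ []) (edge c u ∷ []) (edge d u ∷ [])
      (edge a w ∷ []) (edge b w ∷ []) (edge c w ∷ []) (edge d w ∷ []) (star u F) (star w F)
    where open E

-- Counting edges modulo 3

-- This is m(m-1)/2, the number of edges of K_m, with the recursion of `allEdges`.
triangle : ℕ → ℕ
triangle zero    = 0
triangle (suc m) = m + triangle m

length-allEdges : ∀ xs → length (allEdges xs) ≡ triangle (length xs)
length-allEdges []       = refl
length-allEdges (x ∷ xs)
  rewrite length-++ (map (edge x) xs) {allEdges xs} | length-map (edge x) xs | length-allEdges xs = refl

-- m ≡ 1 + triangle m (mod 3), with both sides moved so that no subtraction occurs.
triangle-mod-3 : ∀ m → m % 3 ≡ 1 ⊎ m % 3 ≡ 2 → ∃[ i ] ∃[ j ] (m + i * 3 ≡ 1 + triangle m + j * 3)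
triangle-mod-3 0 (inj₁ ())
triangle-mod-3 0 (inj₂ ())
triangle-mod-3 1 _ = 0 , 0 , refl
triangle-mod-3 2 _ = 0 , 0 , refl
-- From m to 3 + m the triangle number grows by 3 + 3m but the left side only by 3; the missing 3m
-- is supplied by taking i + m for i.
triangle-mod-3 (suc (suc (suc m))) h with i , j , eq ← triangle-mod-3 m h = i + m , j , (begin
  3 + m + (i + m) * 3
    ≡⟨ solve 2 (λ m i → con 3 :+ m :+ (i :+ m) :* con 3 :=
                        (m :+ i :* con 3) :+ (con 3 :+ m :* con 3)) refl m i ⟩
  (m + i * 3) + (3 + m * 3)         ≡⟨ cong (_+ (3 + m * 3)) eq ⟩
  (1 + T + j * 3) + (3 + m * 3)
    ≡⟨ solve 3 (λ m j t → (con 1 :+ t :+ j :* con 3) :+ (con 3 :+ m :* con 3) :=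
                          con 1 :+ (con 2 :+ m :+ (con 1 :+ m :+ (m :+ t))) :+ j :* con 3) refl m j T ⟩
  1 + triangle (3 + m) + j * 3      ∎)
  where
  T = triangle m
  open +-*-Solver
  open ≡-Reasoning

-- Modulo 3, φ = m - ρ is m - `triangle` m, which is 1. In the application ρ counts the arcs, φ the
-- free vertices and q the paths already split off.
free-count : ∀ m ρ φ q → m % 3 ≡ 1 ⊎ m % 3 ≡ 2 → m ≡ ρ + φ → triangle m ≡ ρ + q * 3 → φ % 3 ≡ 1
free-count m ρ φ q h m≡ T≡ with i , j , eq ← triangle-mod-3 m h = begin
  φ % 3                ≡⟨ [m+kn]%n≡m%n φ i 3 ⟨
  (φ + i * 3) % 3      ≡⟨ cong (_% 3) (+-cancelˡ-≡ ρ _ _ eq′) ⟩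
  (1 + (q + j) * 3) % 3 ≡⟨ [m+kn]%n≡m%n 1 (q + j) 3 ⟩
  1                    ∎
  where
  open ≡-Reasoning
  open +-*-Solver
  eq′ : ρ + (φ + i * 3) ≡ ρ + (1 + (q + j) * 3)
  eq′ = begin
    ρ + (φ + i * 3)          ≡⟨ +-assoc ρ φ _ ⟨
    ρ + φ + i * 3            ≡⟨ cong (_+ i * 3) m≡ ⟨
    m + i * 3                ≡⟨ eq ⟩
    1 + triangle m + j * 3   ≡⟨ cong (λ t → 1 + t + j * 3) T≡ ⟩
    1 + (ρ + q * 3) + j * 3
      ≡⟨ solve 3 (λ r q j → con 1 :+ (r :+ q :* con 3) :+ j :* con 3 :=
                            r :+ (con 1 :+ (q :+ j) :* con 3)) refl ρ q j ⟩
    ρ + (1 + (q + j) * 3)    ∎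

-- Completing edge-disjoint paths to a decomposition

-- The paths of Q are taken out first and never touched again: only the other edges are reduced to
-- arcs and absorbed by u and w. Hence Q survives as part of the final decomposition, which is what
-- a down-link needs.
complete-decomposition :
  ∀ {u w V} (Q : List Path₄) → Unique (u ∷ w ∷ V) → 4 ≤ length V → length V % 3 ≡ 1 ⊎ length V % 3 ≡ 2 →
  Unique (edgesOf Q) → (∀ {e} → e ∈ edgesOf Q → e ∈ allEdges V) →
  ∃[ D ] allEdges (u ∷ w ∷ V) ↭ edgesOf (Q ++ D)
complete-decomposition {u} {w} {V} Q (u∉@(u≢w ∷ u∉V) ∷ w∉V ∷ uV) 4≤ h uQ Q⊆
  with rest , σ ← Unique-⊆⇒↭ (edgesOf Q) uQ Q⊆
  with D₁ , arcs , r ← reduce rest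
         (All.tabulate λ e∈ → allEdges-ordered uV (∈-resp-↭ (↭-sym σ) (∈-++⁺ʳ (edgesOf Q) e∈)))
         (Unique-++⁻ʳ (edgesOf Q) (Unique-resp-↭ σ (allEdges-unique uV)))
  = body
  where
  arc-∈ : ∀ {t h} → (t , h) ∈ arcs → t ∈ V × h ∈ V
  arc-∈ a∈ = ∈-allEdges⇒∈ uV
    (∈-resp-↭ (↭-sym σ) (∈-++⁺ʳ (edgesOf Q) (∈-resp-↭ (↭-sym (perm r)) (∈-++⁺ˡ (∈-map⁺ arcEdge a∈)))))
  head-∈ : ∀ {x} → x ∈ heads arcs → x ∈ V
  head-∈ x∈ with _ , a∈ , refl ← ∈-map⁻ proj₂ x∈ = proj₂ (arc-∈ a∈)
  off : All (Off u w) arcs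
  off = All.tabulate λ a∈ → ≢-sym (All.lookup u∉V (proj₁ (arc-∈ a∈)))
                          , ≢-sym (All.lookup w∉V (proj₁ (arc-∈ a∈)))
                          , All.lookup (loopless r) a∈
  -- Each edge within V lies on a path of Q, on a path of D₁ or on an arc, so the number of arcs is
  -- known modulo 3.
  edge-count : triangle (length V) ≡ length arcs + (length Q + length D₁) * 3
  edge-count = begin
      triangle (length V)                                   ≡⟨ length-allEdges V ⟨
      length (allEdges V)                                   ≡⟨ ↭-length σ ⟩
      length (edgesOf Q ++ rest)                            ≡⟨ length-++ (edgesOf Q) ⟩
      length (edgesOf Q) + length rest                      ≡⟨ cong₂ _+_ (length-edgesOf Q) (↭-length (perm r)) ⟩
      length Q * 3 + length (arcEdges arcs ++ edgesOf D₁)   ≡⟨ cong (length Q * 3 +_) (length-++ (arcEdges arcs)) ⟩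
      length Q * 3 + (length (arcEdges arcs) + length (edgesOf D₁))
        ≡⟨ cong₂ (λ x y → length Q * 3 + (x + y)) (length-map arcEdge arcs) (length-edgesOf D₁) ⟩
      length Q * 3 + (length arcs + length D₁ * 3)
        ≡⟨ solve 3 (λ q a d → q :* con 3 :+ (a :+ d :* con 3) := a :+ (q :+ d) :* con 3) refl
             (length Q) (length arcs) (length D₁) ⟩
      length arcs + (length Q + length D₁) * 3              ∎
    where
    open ≡-Reasoning
    open +-*-Solver using (solve; _:+_; _:*_; _:=_; con)
  body : ∃[ D ] allEdges (u ∷ w ∷ V) ↭ edgesOf (Q ++ D)
  -- F consists of the vertices of V that are not heads.
  body with F , τ ← Unique-⊆⇒↭ (heads arcs) (heads-! r) head-∈
    with D₂ , υ ← join-decomposable u w arcs F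
           (Unique-resp-↭ (prep u (prep w τ)) (u∉ ∷ w∉V ∷ uV)) off
           (free-count (length V) (length arcs) (length F) (length Q + length D₁) h
             (trans (↭-length τ) (trans (length-++ (heads arcs)) (cong (_+ length F) (length-map proj₂ arcs))))
             edge-count)
           (subst (4 ≤_) (↭-length τ) 4≤)
    = D₁ ++ D₂ , ρ
    where
    ρ : allEdges (u ∷ w ∷ V) ↭ edgesOf (Q ++ D₁ ++ D₂)
    ρ = begin
      edge u w ∷ map (edge u) V ++ map (edge w) V ++ allEdges V
        ↭⟨ prep _ (++⁺ (split u) (++⁺ (split w) (↭-trans σ (++⁺ˡ (edgesOf Q) (perm r))))) ⟩
      edge u w ∷ (star u H ++ star u F) ++ (star w H ++ star w F) ++ edgesOf Q ++ arcEdges arcs ++ edgesOf D₁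
        ↭⟨ E.solve 8 (λ uw UH UF WH WF q A d →
             uw E.⊕ (UH E.⊕ UF) E.⊕ (WH E.⊕ WF) E.⊕ q E.⊕ A E.⊕ d E.⊜
             q E.⊕ d E.⊕ (uw E.⊕ A E.⊕ UH E.⊕ WH E.⊕ UF E.⊕ WF)) ↭-refl
             (edge u w ∷ []) (star u H) (star u F) (star w H) (star w F)
             (edgesOf Q) (arcEdges arcs) (edgesOf D₁) ⟩
      edgesOf Q ++ edgesOf D₁ ++ edge u w ∷ unattached u w arcs F
        ↭⟨ ++⁺ˡ (edgesOf Q) (++⁺ˡ (edgesOf D₁) υ) ⟩
      edgesOf Q ++ edgesOf D₁ ++ edgesOf D₂
        ≡⟨ cong (edgesOf Q ++_) (edgesOf-++ D₁ D₂) ⟨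
      edgesOf Q ++ edgesOf (D₁ ++ D₂)
        ≡⟨ edgesOf-++ Q (D₁ ++ D₂) ⟨
      edgesOf (Q ++ D₁ ++ D₂) ∎
      where
      open PermutationReasoning
      H = heads arcs
      split : ∀ c → map (edge c) V ↭ star c H ++ star c F
      split c = ↭-trans (↭-reflexive (map-cong (edge-comm c) V))
                  (↭-trans (map⁺ _ τ) (↭-reflexive (map-++ _ H F)))

-- Decompositions as designs

verticesOf : Path₄ → List ℕ
verticesOf p = p₀ p ∷ p₁ p ∷ p₂ p ∷ p₃ p ∷ []

at : Path₄ → ℕ → ℕ
at p 0 = p₀ p
at p 1 = p₁ p
at p 2 = p₂ p
-- Indices beyond 3 also land on the path, so `at-∈` holds for every index.
at p _ = p₃ p

position : Path₄ → ℕ → ℕ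
position p x with x ≟ p₀ p | x ≟ p₁ p | x ≟ p₂ p
... | yes _ | _     | _     = 0
... | no  _ | yes _ | _     = 1
... | no  _ | no  _ | yes _ = 2
-- This is also the default for vertices off the path, which keeps `position<4` unconditional.
... | no  _ | no  _ | no  _ = 3

position<4 : ∀ p x → position p x < 4
position<4 p x with x ≟ p₀ p | x ≟ p₁ p | x ≟ p₂ p
... | yes _ | _     | _     = s≤s z≤n
... | no  _ | yes _ | _     = s≤s (s≤s z≤n)
... | no  _ | no  _ | yes _ = s≤s (s≤s (s≤s z≤n))
... | no  _ | no  _ | no  _ = ≤-refl

at-position : ∀ p {x} → x ∈ verticesOf p → at p (position p x) ≡ x
at-position p {x} x∈ with x ≟ p₀ p | x ≟ p₁ p | x ≟ p₂ p | x∈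
... | yes eq | _      | _      | _ = sym eq
... | no  _  | yes eq | _      | _ = sym eq
... | no  _  | no  _  | yes eq | _ = sym eq
... | no  x≢ | _      | _      | here eq = contradiction eq x≢
... | no  _  | no  x≢ | _      | there (here eq) = contradiction eq x≢
... | no  _  | no  _  | no  x≢ | there (there (here eq)) = contradiction eq x≢
... | no  _  | no  _  | no  _  | there (there (there (here eq))) = sym eq

at-∈ : ∀ p i → at p i ∈ verticesOf p
at-∈ p 0 = here refl
at-∈ p 1 = there (here refl)
at-∈ p 2 = there (there (here refl))
at-∈ p (suc (suc (suc _))) = there (there (there (here refl)))

at-injective : ∀ p {i j} → i < 4 → j < 4 → at p i ≡ at p j → i ≡ j
at-injective (path a b c d ((ab ∷ ac ∷ ad ∷ []) ∷ (bc ∷ bd ∷ []) ∷ (cd ∷ []) ∷ [] ∷ [])) {i} {j} = go i j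
  where
  p = path a b c d ((ab ∷ ac ∷ ad ∷ []) ∷ (bc ∷ bd ∷ []) ∷ (cd ∷ []) ∷ [] ∷ [])
  go : ∀ i j → i < 4 → j < 4 → at p i ≡ at p j → i ≡ j
  go 0 0 _ _ _  = refl
  go 0 1 _ _ eq = contradiction eq ab
  go 0 2 _ _ eq = contradiction eq ac
  go 0 3 _ _ eq = contradiction eq ad
  go 1 0 _ _ eq = contradiction (sym eq) ab
  go 1 1 _ _ _  = refl
  go 1 2 _ _ eq = contradiction eq bc
  go 1 3 _ _ eq = contradiction eq bd
  go 2 0 _ _ eq = contradiction (sym eq) ac
  go 2 1 _ _ eq = contradiction (sym eq) bc
  go 2 2 _ _ _  = refl
  go 2 3 _ _ eq = contradiction eq cd
  go 3 0 _ _ eq = contradiction (sym eq) ad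
  go 3 1 _ _ eq = contradiction (sym eq) bd
  go 3 2 _ _ eq = contradiction (sym eq) cd
  go 3 3 _ _ _  = refl
  go (suc (suc (suc (suc _)))) _ (s≤s (s≤s (s≤s (s≤s ())))) _ _
  go _ (suc (suc (suc (suc _)))) _ (s≤s (s≤s (s≤s (s≤s ())))) _

position-at : ∀ p {i} → i < 4 → position p (at p i) ≡ i
position-at p {i} i<4 = at-injective p (position<4 p _) i<4 (at-position p (at-∈ p i))

∈-edges⁺ : ∀ p {i} → suc i < 4 → edge (at p i) (at p (suc i)) ∈ edges p
∈-edges⁺ p {0} _ = here refl
∈-edges⁺ p {1} _ = there (here refl)
∈-edges⁺ p {2} _ = there (there (here refl))
∈-edges⁺ p {suc (suc (suc _))} (s≤s (s≤s (s≤s (s≤s ()))))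

∈-edges⁻ : ∀ p {e} → e ∈ edges p → ∃[ i ] (suc i < 4 × e ≡ edge (at p i) (at p (suc i)))
∈-edges⁻ p (here eq)                 = 0 , s≤s (s≤s z≤n) , eq
∈-edges⁻ p (there (here eq))         = 1 , s≤s (s≤s (s≤s z≤n)) , eq
∈-edges⁻ p (there (there (here eq))) = 2 , ≤-refl , eq

∈-edges-ends : ∀ p {x y} → edge x y ∈ edges p →
               ∃[ i ] (suc i < 4 × (x ≡ at p i × y ≡ at p (suc i) ⊎ x ≡ at p (suc i) × y ≡ at p i))
∈-edges-ends p e∈ with i , i< , eq ← ∈-edges⁻ p e∈ =
  i , i< , edge-injective (λ at≡ → 1+n≢n (sym (at-injective p (<⇒≤ i<) i< at≡))) eq

edges-unique : ∀ p → Unique (edges p)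
edges-unique p@(path a b c d ((ab ∷ ac ∷ ad ∷ []) ∷ (bc ∷ bd ∷ []) ∷ (cd ∷ []) ∷ [] ∷ [])) =
  (ab≢bc ∷ ab≢cd ∷ []) ∷ (bc≢cd ∷ []) ∷ [] ∷ []
  where
  ab≢bc : edge a b ≢ edge b c
  ab≢bc eq with edge-injective bc eq
  ... | inj₁ (a≡b , _) = ab a≡b
  ... | inj₂ (a≡c , _) = ac a≡c
  ab≢cd : edge a b ≢ edge c d
  ab≢cd eq with edge-injective cd eq
  ... | inj₁ (a≡c , _) = ac a≡c
  ... | inj₂ (a≡d , _) = ad a≡d
  bc≢cd : edge b c ≢ edge c d
  bc≢cd eq with edge-injective cd eq
  ... | inj₁ (b≡c , _) = bc b≡c
  ... | inj₂ (b≡d , _) = bd b≡d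

pathGraph : Path₄ → Graph
pathGraph p = record
  { vertices   = verticesOf p
  ; Adj        = λ x y → edge x y ∈ edges p
  ; adj?       = λ x y → edge x y ∈ᴱ? edges p
  ; adj-sym    = λ {x} {y} → subst (_∈ edges p) (edge-comm x y)
  ; adj-irrefl = irrefl
  ; adj-vertex = vertex
  }
  where
  irrefl : ∀ {x y} → x ≡ y → ¬ (edge x y ∈ edges p)
  irrefl refl e∈ with ∈-edges-ends p e∈
  ... | i , i< , inj₁ (eq , eq′) = 1+n≢n (sym (at-injective p (<⇒≤ i<) i< (trans (sym eq) eq′)))
  ... | i , i< , inj₂ (eq , eq′) = 1+n≢n (at-injective p i< (<⇒≤ i<) (trans (sym eq) eq′))
  vertex : ∀ {x y} → edge x y ∈ edges p → x ∈ verticesOf p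
  vertex e∈ with ∈-edges-ends p e∈
  ... | i , _ , inj₁ (refl , _) = at-∈ p i
  ... | i , _ , inj₂ (refl , _) = at-∈ p (suc i)

pathGraph≅P₄ : ∀ p → pathGraph p ≅ P 4
pathGraph≅P₄ p = record
  { to      = position p
  ; from    = at p
  ; to-∈    = λ _ → ∈-upTo⁺ (position<4 p _)
  ; from-∈  = λ {i} _ → at-∈ p i
  ; from∘to = at-position p
  ; to∘from = λ i∈ → position-at p (∈-upTo⁻ i∈)
  ; adj-⇔   = λ x∈ y∈ → mk⇔ to-adj (from-adj x∈ y∈)
  }
  where
  to-adj : ∀ {x y} → edge x y ∈ edges p → Adj (P 4) (position p x) (position p y)
  to-adj e∈ with ∈-edges-ends p e∈
  ... | i , i< , inj₁ (refl , refl) = position<4 p _ , position<4 p _ ,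
    inj₁ (trans (position-at p i<) (cong suc (sym (position-at p (<⇒≤ i<)))))
  ... | i , i< , inj₂ (refl , refl) = position<4 p _ , position<4 p _ ,
    inj₂ (trans (position-at p i<) (cong suc (sym (position-at p (<⇒≤ i<)))))
  from-adj : ∀ {x y} → x ∈ verticesOf p → y ∈ verticesOf p →
             Adj (P 4) (position p x) (position p y) → edge x y ∈ edges p
  from-adj {x} {y} x∈ y∈ (i<4 , j<4 , inj₁ j≡) =
    subst₂ (λ x y → edge x y ∈ edges p) (at-position p x∈)
      (trans (cong (at p) (sym j≡)) (at-position p y∈)) (∈-edges⁺ p (subst (_< 4) j≡ j<4))
  from-adj {x} {y} x∈ y∈ (i<4 , j<4 , inj₂ i≡) =
    subst (_∈ edges p) (edge-comm y x)
      (subst₂ (λ y x → edge y x ∈ edges p) (at-position p y∈)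
        (trans (cong (at p) (sym i≡)) (at-position p x∈)) (∈-edges⁺ p (subst (_< 4) i≡ i<4)))

pathGraph-⊑ : ∀ {G} p → All (_∈ vertices G) (verticesOf p) →
              (∀ i → suc i < 4 → Adj G (at p i) (at p (suc i))) → pathGraph p ⊑ G
pathGraph-⊑ {G} p vs adj = All.lookup vs , λ e∈ → adj′ (∈-edges-ends p e∈)
  where
  adj′ : ∀ {x y} → ∃[ i ] (suc i < 4 × (x ≡ at p i × y ≡ at p (suc i) ⊎ x ≡ at p (suc i) × y ≡ at p i)) → Adj G x y
  adj′ (i , i< , inj₁ (refl , refl)) = adj i i<
  adj′ (i , i< , inj₂ (refl , refl)) = adj-sym G (adj i i<)

completeOn : List ℕ → Graph
completeOn xs = record
  { vertices   = xs
  ; Adj        = λ x y → x ∈ xs × y ∈ xs × x ≢ y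
  ; adj?       = λ x y → (x ∈? xs) ×-dec ((y ∈? xs) ×-dec ¬? (x ≟ y))
  ; adj-sym    = λ (x∈ , y∈ , x≢y) → y∈ , x∈ , ≢-sym x≢y
  ; adj-irrefl = λ x≡y (_ , _ , x≢y) → x≢y x≡y
  ; adj-vertex = proj₁
  }

pathGraph-⊑-completeOn : ∀ {xs} p → All (_∈ xs) (verticesOf p) → pathGraph p ⊑ completeOn xs
pathGraph-⊑-completeOn {xs} p vs = pathGraph-⊑ {completeOn xs} p vs λ i i< →
  All.lookup vs (at-∈ p i) , All.lookup vs (at-∈ p (suc i)) ,
  λ at≡ → 1+n≢n (sym (at-injective p (<⇒≤ i<) i< at≡))

edges⊆allEdges : ∀ {xs} p → All (_∈ xs) (verticesOf p) → ∀ {e} → e ∈ edges p → e ∈ allEdges xs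
edges⊆allEdges p vs e∈ with i , i< , refl ← ∈-edges⁻ p e∈ =
  ∈-allEdges⁺ (All.lookup vs (at-∈ p i)) (All.lookup vs (at-∈ p (suc i)))
    (λ eq → 1+n≢n (sym (at-injective p (<⇒≤ i<) i< eq)))

-- The first and the last edge already contain all four vertices.
edges⊆⇒vertices⊆ : ∀ {xs} p → Unique xs → (∀ {e} → e ∈ edges p → e ∈ allEdges xs) → All (_∈ xs) (verticesOf p)
edges⊆⇒vertices⊆ p uxs e⊆ with ∈-allEdges⇒∈ uxs (e⊆ (here refl)) | ∈-allEdges⇒∈ uxs (e⊆ (there (there (here refl))))
... | a∈ , b∈ | c∈ , d∈ = a∈ ∷ b∈ ∷ c∈ ∷ d∈ ∷ []

∈-edgesOf⁺ : ∀ D {e} (i : Fin (length D)) → e ∈ edges (lookup D i) → e ∈ edgesOf D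
∈-edgesOf⁺ (p ∷ D) Fin.zero    e∈ = ∈-++⁺ˡ e∈
∈-edgesOf⁺ (p ∷ D) (Fin.suc i) e∈ = ∈-++⁺ʳ (edges p) (∈-edgesOf⁺ D i e∈)

Unique-++⇒disjoint : ∀ {A : Set} (xs : List A) {ys x} → Unique (xs ++ ys) → x ∈ xs → ¬ (x ∈ ys)
Unique-++⇒disjoint (x ∷ xs) (x∉ ∷ u) (here refl) x∈ys = All.lookup x∉ (∈-++⁺ʳ xs x∈ys) refl
Unique-++⇒disjoint (x ∷ xs) (x∉ ∷ u) (there z∈)  z∈ys = Unique-++⇒disjoint xs u z∈ z∈ys

-- An edge on two different entries of D would be repeated in the concatenation.
edgesOf-index-unique : ∀ D {e} → Unique (edgesOf D) → (i j : Fin (length D)) →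
                       e ∈ edges (lookup D i) → e ∈ edges (lookup D j) → i ≡ j
edgesOf-index-unique (p ∷ D) u Fin.zero    Fin.zero    e∈ e∈′ = refl
edgesOf-index-unique (p ∷ D) u Fin.zero    (Fin.suc j) e∈ e∈′ =
  contradiction (∈-edgesOf⁺ D j e∈′) (Unique-++⇒disjoint (edges p) u e∈)
edgesOf-index-unique (p ∷ D) u (Fin.suc i) Fin.zero    e∈ e∈′ =
  contradiction (∈-edgesOf⁺ D i e∈) (Unique-++⇒disjoint (edges p) u e∈′)
edgesOf-index-unique (p ∷ D) u (Fin.suc i) (Fin.suc j) e∈ e∈′ =
  cong Fin.suc (edgesOf-index-unique D (Unique-++⁻ʳ (edges p) u) i j e∈ e∈′)

decomposition⇒design : ∀ {xs} → Unique xs → P 4 ≤ᴳ completeOn xs → (D : List Path₄) →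
                       allEdges xs ↭ edgesOf D → Design (completeOn xs) (P 4)
decomposition⇒design {xs} uxs P₄≤ D perm = record
  { Γ≤G       = P₄≤
  ; size      = length D
  ; block     = pathGraph ∘ lookup D
  -- Equal blocks share the first edge of block i, and an edge determines its block.
  ; distinct  = λ {i} {j} ((_ , ⊑) , _) → edgesOf-index-unique D uD i j (here refl) (⊑ (here refl))
  ; block⊑G   = λ i → pathGraph-⊑-completeOn (lookup D i)
                  (edges⊆⇒vertices⊆ (lookup D i) uxs (λ e∈ → ∈-resp-↭ (↭-sym perm) (∈-edgesOf⁺ D i e∈)))
  ; block≅Γ   = λ i → pathGraph≅P₄ (lookup D i)
  ; partition = λ (x∈ , y∈ , x≢y) → unique-block (∈-resp-↭ perm (∈-allEdges⁺ x∈ y∈ x≢y))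
  }
  where
  uD : Unique (edgesOf D)
  uD = Unique-resp-↭ perm (allEdges-unique uxs)
  unique-block : ∀ {e} → e ∈ edgesOf D →
                 ∃[ i ] (e ∈ edges (lookup D i) × (∀ {j} → e ∈ edges (lookup D j) → i ≡ j))
  unique-block e∈ with any ← ∈-concatMap⁻ edges {xs = D} e∈ =
    Any.index any , lookup-index any , λ e∈′ → edgesOf-index-unique D uD _ _ (lookup-index any) e∈′

edgesOf-tabulate-unique : ∀ {N} (p : Fin N → Path₄) →
  (∀ {i j e} → e ∈ edges (p i) → e ∈ edges (p j) → i ≡ j) → Unique (edgesOf (tabulate p))
edgesOf-tabulate-unique p index-unique = Unique.concat⁺
  (All.map⁺ (All.tabulate⁺ (edges-unique ∘ p)))
  (AllPairs.map⁺ (AllPairs.tabulate⁺ λ i≢j (e∈ , e∈′) → i≢j (index-unique e∈ e∈′)))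

completeOn≅K : ∀ n (g g⁻¹ : ℕ → ℕ) → (∀ i → g⁻¹ (g i) ≡ i) → completeOn (map g (downFrom n)) ≅ K n
completeOn≅K n g g⁻¹ inv = record
  { to      = g⁻¹
  ; from    = g
  ; to-∈    = λ x∈ → ∈-upTo⁺ (g⁻¹-< x∈)
  ; from-∈  = λ i∈ → ∈-map⁺ g (∈-downFrom⁺ (∈-upTo⁻ i∈))
  ; from∘to = g-g⁻¹
  ; to∘from = λ _ → inv _
  ; adj-⇔   = λ x∈ y∈ → mk⇔
      (λ (_ , _ , x≢y) → g⁻¹-< x∈ , g⁻¹-< y∈ ,
        λ eq → x≢y (trans (sym (g-g⁻¹ x∈)) (trans (cong g eq) (g-g⁻¹ y∈))))
      (λ (_ , _ , ≢) → x∈ , y∈ , λ x≡y → ≢ (cong g⁻¹ x≡y))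
  }
  where
  g⁻¹-< : ∀ {x} → x ∈ map g (downFrom n) → g⁻¹ x < n
  g⁻¹-< x∈ with i , i∈ , refl ← ∈-map⁻ g x∈ = subst (_< n) (sym (inv i)) (∈-downFrom⁻ i∈)
  g-g⁻¹ : ∀ {x} → x ∈ map g (downFrom n) → g (g⁻¹ x) ≡ x
  g-g⁻¹ x∈ with i , i∈ , refl ← ∈-map⁻ g x∈ = cong g (inv i)

-- Extracting a path from every block

-- Pigeonhole: if each of the t segments of length 4 had a value of at least m, subtracting m would
-- send the t segments to b < t excesses. Two equal excesses contradict the injectivity of c.
segment-below : ∀ {t b m} (c : Fin (t * 4) → ℕ) → (∀ {i j} → c i ≡ c j → i ≡ j) →
                (∀ i → c i < m + b) → b < t → ∃[ j ] ∀ r → c (combine j r) < m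
segment-below {t} {b} {m} c c-injective c< b<t with Fin.any? {n = t} (λ j → Fin.all? {n = 4} λ r → c (combine j r) <? m)
... | yes segment = segment
... | no ¬segment = clash (Fin.pigeonhole b<t excess)
  where
  open ≡-Reasoning
  bad : ∀ j → Σ[ r ∈ Fin 4 ] ¬ (c (combine j r) < m)
  bad j = Fin.¬∀⟶∃¬ 4 _ (λ r → c (combine j r) <? m) (λ all → ¬segment (j , all))
  m≤ : ∀ j → m ≤ c (combine j (proj₁ (bad j)))
  m≤ j = ≮⇒≥ (proj₂ (bad j))
  excess< : ∀ j → c (combine j (proj₁ (bad j))) ∸ m < b
  excess< j = +-cancelˡ-< m _ b (subst (_< m + b) (sym (m+[n∸m]≡n (m≤ j))) (c< _))
  excess : Fin t → Fin b
  excess j = fromℕ< (excess< j)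
  clash : ∃[ i ] ∃[ j ] (i Fin.< j × excess i ≡ excess j) → ∃[ j ] ∀ r → c (combine j r) < m
  clash (i , j , i<j , eq) = contradiction (Fin.combine-injectiveˡ i _ j _ (c-injective (begin
    c (combine i (proj₁ (bad i)))              ≡⟨ m+[n∸m]≡n (m≤ i) ⟨
    m + (c (combine i (proj₁ (bad i))) ∸ m)    ≡⟨ cong (m +_) (Fin.fromℕ<-injective _ _ (excess< i) (excess< j) eq) ⟩
    m + (c (combine j (proj₁ (bad j))) ∸ m)    ≡⟨ m+[n∸m]≡n (m≤ j) ⟩
    c (combine j (proj₁ (bad j)))              ∎)))
    (Fin.<⇒≢ i<j)

segment-below-ℕ : ∀ t {b m} (c : ℕ → ℕ) → (∀ {i j} → i < t * 4 → j < t * 4 → c i ≡ c j → i ≡ j) →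
                  (∀ {i} → i < t * 4 → c i < m + b) → b < t →
                  ∃[ o ] ∀ r → r < 4 → r + o < t * 4 × c (r + o) < m
segment-below-ℕ t {b} {m} c c-injective c< b<t
  with j , below ← segment-below {t} {b} {m} (c ∘ toℕ)
         (λ {i} {j} eq → Fin.toℕ-injective (c-injective (Fin.toℕ<n i) (Fin.toℕ<n j) eq))
         (λ i → c< (Fin.toℕ<n i)) b<t
  = 4 * toℕ j , λ r r<4 →
      let eq = trans (Fin.toℕ-combine j (fromℕ< r<4))
                 (trans (+-comm _ (toℕ (fromℕ< r<4))) (cong (_+ 4 * toℕ j) (Fin.toℕ-fromℕ< r<4)))
      in subst (_< t * 4) eq (Fin.toℕ<n (combine j (fromℕ< r<4))) , subst (λ l → c l < m) eq (below (fromℕ< r<4))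

order-mod-3 : ∀ m → (2 + m) % 3 ≡ 0 ⊎ (2 + m) % 3 ≡ 1 → m % 3 ≡ 1 ⊎ m % 3 ≡ 2
order-mod-3 0 (inj₁ ())
order-mod-3 0 (inj₂ ())
order-mod-3 1 _ = inj₁ refl
order-mod-3 2 _ = inj₂ refl
order-mod-3 (suc (suc (suc m))) h = order-mod-3 m h

≅-to-injective : ∀ {G H} (iso : G ≅ H) → ∀ {x y} → x ∈ vertices G → y ∈ vertices G →
                 _≅_.to iso x ≡ _≅_.to iso y → x ≡ y
≅-to-injective iso x∈ y∈ eq = trans (sym (from∘to x∈)) (trans (cong from eq) (from∘to y∈))
  where open _≅_ iso

≅-from-injective : ∀ {G H} (iso : G ≅ H) → ∀ {x y} → x ∈ vertices H → y ∈ vertices H →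
                   _≅_.from iso x ≡ _≅_.from iso y → x ≡ y
≅-from-injective iso x∈ y∈ eq = trans (sym (to∘from x∈)) (trans (cong to eq) (to∘from y∈))
  where open _≅_ iso

≅K-to-< : ∀ {G v} (iso : G ≅ K v) → ∀ {x} → x ∈ vertices G → _≅_.to iso x < v
≅K-to-< iso x∈ = ∈-upTo⁻ (_≅_.to-∈ iso x∈)

-- The vertices of the path are numbered injectively by elements of `Fin v`. This gives the lower
-- bound on v from which the target order is seen to be large enough.
P≤ᴳ⇒≤ : ∀ {G k v} → P k ≤ᴳ G → G ≅ K v → k ≤ v
P≤ᴳ⇒≤ {G} {k} (S , S⊑G , S≅P) G≅K = Fin.injective⇒≤ {f = λ i → fromℕ< (≅K-to-< G≅K (∈G i))} λ {i} {j} eq →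
  Fin.toℕ-injective (≅-from-injective S≅P (∈P i) (∈P j)
    (≅-to-injective G≅K (∈G i) (∈G j) (Fin.fromℕ<-injective _ _ (≅K-to-< G≅K (∈G i)) (≅K-to-< G≅K (∈G j)) eq)))
  where
  ∈P : (i : Fin k) → toℕ i ∈ vertices (P k)
  ∈P i = ∈-upTo⁺ (Fin.toℕ<n i)
  ∈G : (i : Fin k) → _≅_.from S≅P (toℕ i) ∈ vertices G
  ∈G i = proj₁ S⊑G (_≅_.from-∈ S≅P (∈P i))

-- With s = (k ∸ 12) / 4, the left side is (3 + s) * 4, the number of vertices in s + 3 disjoint
-- copies of P₄.
12+[k∸12]/4*4≤k : ∀ {k} → 12 ≤ k → 12 + (k ∸ 12) / 4 * 4 ≤ k
12+[k∸12]/4*4≤k {k} 12≤k = begin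
  12 + (k ∸ 12) / 4 * 4  ≤⟨ +-monoʳ-≤ 12 (m/n*n≤m (k ∸ 12) 4) ⟩
  12 + (k ∸ 12)          ≡⟨ m+[n∸m]≡n 12≤k ⟩
  k                      ∎
  where open ≤-Reasoning

-- The last component records the positions of the four vertices in the long path, so that a bound
-- known for consecutive positions carries over to p.
subpath : ∀ {G k} (iso : G ≅ P k) o → 3 + o < k →
          Σ[ p ∈ Path₄ ] (pathGraph p ⊑ G × All (λ x → ∃[ r ] (r < 4 × x ≡ _≅_.from iso (r + o))) (verticesOf p))
subpath {G} {k} iso o 3+o<k = p , p⊑ ,
  (0 , 0<4 , refl) ∷ (1 , 1<4 , refl) ∷ (2 , 2<4 , refl) ∷ (3 , 3<4 , refl) ∷ []
  where
  open _≅_ iso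
  0<4 : 0 < 4
  0<4 = s≤s z≤n
  1<4 : 1 < 4
  1<4 = s≤s (s≤s z≤n)
  2<4 : 2 < 4
  2<4 = s≤s (s≤s (s≤s z≤n))
  3<4 : 3 < 4
  3<4 = ≤-refl
  r+o<k : ∀ {r} → r < 4 → r + o < k
  r+o<k (s≤s r≤3) = ≤-<-trans (+-monoˡ-≤ o r≤3) 3+o<k
  distinct-from : ∀ {r r′} → r < 4 → r′ < 4 → r ≢ r′ → from (r + o) ≢ from (r′ + o)
  distinct-from r<4 r′<4 r≢r′ eq = r≢r′ (+-cancelʳ-≡ o _ _
    (≅-from-injective iso (∈-upTo⁺ (r+o<k r<4)) (∈-upTo⁺ (r+o<k r′<4)) eq))
  p : Path₄
  p = mkPath (from o) (from (1 + o)) (from (2 + o)) (from (3 + o))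
    (distinct-from 0<4 1<4 λ ()) (distinct-from 0<4 2<4 λ ()) (distinct-from 0<4 3<4 λ ())
    (distinct-from 1<4 2<4 λ ()) (distinct-from 1<4 3<4 λ ()) (distinct-from 2<4 3<4 λ ())
  ∈G : ∀ {r} → r < 4 → from (r + o) ∈ vertices G
  ∈G r<4 = from-∈ (∈-upTo⁺ (r+o<k r<4))
  adj : ∀ {r} → suc r < 4 → Adj G (from (r + o)) (from (suc r + o))
  adj {r} sr<4 = Equivalence.from (adj-⇔ (∈G r<4) (∈G sr<4))
    (subst₂ (Adj (P k)) (sym (to∘from (∈-upTo⁺ (r+o<k r<4)))) (sym (to∘from (∈-upTo⁺ (r+o<k sr<4))))
      (r+o<k r<4 , r+o<k sr<4 , inj₁ refl))
    where r<4 = <⇒≤ sr<4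
  p⊑ : pathGraph p ⊑ G
  p⊑ = pathGraph-⊑ {G} p (∈G 0<4 ∷ ∈G 1<4 ∷ ∈G 2<4 ∷ ∈G 3<4 ∷ []) λ where
    0 _ → adj {0} 1<4
    1 _ → adj {1} 2<4
    2 _ → adj {2} 3<4
    (suc (suc (suc _))) (s≤s (s≤s (s≤s (s≤s ()))))

subpath-below : ∀ {G H k v} s m (G≅K : G ≅ K v) → H ⊑ G → H ≅ P k → 12 + s * 4 ≤ k → v ≤ 2 + m + s →
                Σ[ p ∈ Path₄ ] (pathGraph p ⊑ H × All (λ x → x ∈ vertices G × _≅_.to G≅K x < m) (verticesOf p))
subpath-below {G} {H} {k} {v} s m G≅K H⊑G H≅P 12+s*4≤k v≤ = extract
  -- There are 3 + s disjoint segments, but at most 2 + s vertices of the host are numbered m or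
  -- higher.
  (segment-below-ℕ (3 + s) {2 + s} {m} (λ l → to G≅K (from H≅P l))
    (λ i< j< eq → ≅-from-injective H≅P (∈P i<) (∈P j<) (≅-to-injective G≅K (∈G i<) (∈G j<) eq))
    (λ i< → <-≤-trans (≅K-to-< G≅K (∈G i<)) (≤-trans v≤ (≤-reflexive 2+m+s≡m+[2+s])))
    ≤-refl)
  where
  open _≅_
  2+m+s≡m+[2+s] : 2 + m + s ≡ m + (2 + s)
  2+m+s≡m+[2+s] = trans (cong (_+ s) (+-comm 2 m)) (+-assoc m 2 s)
  ∈P : ∀ {i} → i < (3 + s) * 4 → i ∈ vertices (P k)
  ∈P i< = ∈-upTo⁺ (<-≤-trans i< 12+s*4≤k)
  ∈G : ∀ {i} → i < (3 + s) * 4 → from H≅P i ∈ vertices G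
  ∈G i< = proj₁ H⊑G (from-∈ H≅P (∈P i<))
  extract : ∃[ o ] (∀ r → r < 4 → r + o < (3 + s) * 4 × to G≅K (from H≅P (r + o)) < m) →
            Σ[ p ∈ Path₄ ] (pathGraph p ⊑ H × All (λ x → x ∈ vertices G × to G≅K x < m) (verticesOf p))
  extract (o , below) with p , p⊑H , vs ← subpath H≅P o (<-≤-trans (proj₁ (below 3 ≤-refl)) 12+s*4≤k) =
    p , p⊑H , All.map (λ { (r , r<4 , refl) → ∈G (proj₁ (below r r<4)) , proj₂ (below r r<4) }) vs

-- The target design and the down-link

module DownLinking (k v m : ℕ) (12≤k : 12 ≤ k) (4≤m : 4 ≤ m) (B : DesignOfOrder (P k) v)
  (v≤ : v ≤ 2 + m + (k ∸ 12) / 4) (mod : m % 3 ≡ 1 ⊎ m % 3 ≡ 2) where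

  open DesignOfOrder B
  module H = _≅_ host≅K

  -- All numbers from here on are outside the host and can serve as new vertices.
  bound : ℕ
  bound = suc (max 0 (vertices host))

  ∈-host⇒< : ∀ {x} → x ∈ vertices host → x < bound
  ∈-host⇒< x∈ = s≤s (All.lookup (xs≤max 0 (vertices host)) x∈)

  -- g extends the given numbering of the host by new vertices to an injection of ℕ.
  g g⁻¹ : ℕ → ℕ
  g i with i <? v
  ... | yes _ = H.from i
  ... | no  _ = bound + i
  g⁻¹ x with x <? bound
  ... | yes _ = H.to x
  ... | no  _ = x ∸ bound

  g⁻¹-g : ∀ i → g⁻¹ (g i) ≡ i
  g⁻¹-g i with i <? v
  ... | yes i<v with H.from i <? bound
  ...   | yes _ = H.to∘from (∈-upTo⁺ i<v)
  ...   | no  ≮ = contradiction (∈-host⇒< (H.from-∈ (∈-upTo⁺ i<v))) ≮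
  g⁻¹-g i | no _ with bound + i <? bound
  ...   | yes b+i<b = contradiction b+i<b (m+n≮m bound i)
  ...   | no  _ = m+n∸m≡n bound i

  g-injective : ∀ {i j} → g i ≡ g j → i ≡ j
  g-injective {i} {j} eq = trans (sym (g⁻¹-g i)) (trans (cong g⁻¹ eq) (g⁻¹-g j))

  g-to : ∀ {x} → x ∈ vertices host → g (H.to x) ≡ x
  g-to {x} x∈ with H.to x <? v
  ... | yes _ = H.from∘to x∈
  ... | no  ≮ = contradiction (≅K-to-< host≅K x∈) ≮

  V xs : List ℕ
  V = map g (downFrom m)
  -- By definition of downFrom, this is g (1 + m) ∷ g m ∷ V: the first two entries
  -- are the apex vertices u and w.
  xs = map g (downFrom (2 + m))

  xs-unique : Unique xs
  xs-unique = Unique.map⁺ g-injective (Unique.downFrom⁺ (2 + m))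

  length-V : length V ≡ m
  length-V = trans (length-map g (downFrom m)) (length-downFrom m)

  P₄≤completeOn : P 4 ≤ᴳ completeOn xs
  P₄≤completeOn = pathGraph p , pathGraph-⊑-completeOn p vs , pathGraph≅P₄ p
    where
    distinct-g : ∀ {i j} → i ≢ j → g i ≢ g j
    distinct-g i≢j = i≢j ∘ g-injective
    p : Path₄
    p = mkPath (g 0) (g 1) (g 2) (g 3)
      (distinct-g λ ()) (distinct-g λ ()) (distinct-g λ ()) (distinct-g λ ()) (distinct-g λ ()) (distinct-g λ ())
    ∈xs : ∀ {i} → i < 4 → g i ∈ xs
    ∈xs i<4 = ∈-map⁺ g (∈-downFrom⁺ (<-≤-trans i<4 (≤-trans 4≤m (m≤n+m m 2))))
    vs : All (_∈ xs) (verticesOf p)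
    vs = ∈xs (s≤s z≤n) ∷ ∈xs (s≤s (s≤s z≤n)) ∷ ∈xs (s≤s (s≤s (s≤s z≤n))) ∷ ∈xs ≤-refl ∷ []

  opaque
    protectedPath : ∀ i → Σ[ p ∈ Path₄ ]
      (pathGraph p ⊑ block i × All (λ x → x ∈ vertices host × H.to x < m) (verticesOf p))
    protectedPath i =
      subpath-below ((k ∸ 12) / 4) m host≅K (block⊑G i) (block≅Γ i) (12+[k∸12]/4*4≤k 12≤k) v≤

  protected : Fin size → Path₄
  protected i = proj₁ (protectedPath i)

  protected⊑block : ∀ i → pathGraph (protected i) ⊑ block i
  protected⊑block i = proj₁ (proj₂ (protectedPath i))

  protected⊆V : ∀ i → All (_∈ V) (verticesOf (protected i))
  protected⊆V i = All.map (λ (x∈ , x<m) → subst (_∈ V) (g-to x∈) (∈-map⁺ g (∈-downFrom⁺ x<m)))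
    (proj₂ (proj₂ (protectedPath i)))

  -- A common edge would lie in both block i and block j, and the blocks partition the edges of the
  -- host.
  protected-disjoint : ∀ {i j e} → e ∈ edges (protected i) → e ∈ edges (protected j) → i ≡ j
  protected-disjoint {i} {j} e∈i e∈j with r , _ , refl ← ∈-edges⁻ (protected i) e∈i
    with adj ← proj₂ (protected⊑block i) e∈i
    with _ , _ , unique ← partition (proj₂ (block⊑G i) adj)
    = trans (sym (unique adj)) (unique (proj₂ (protected⊑block j) e∈j))

  ∈-edgesOf-protected : ∀ {e} → e ∈ edgesOf (tabulate protected) → e ∈ allEdges V
  ∈-edgesOf-protected e∈ with find (∈-concatMap⁻ edges {xs = tabulate protected} e∈)
  ... | p , p∈ , e∈p with i , refl ← ∈-tabulate⁻ p∈ = edges⊆allEdges (protected i) (protected⊆V i) e∈p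

  decomposition : ∃[ D ] allEdges xs ↭ edgesOf (tabulate protected ++ D)
  decomposition = complete-decomposition (tabulate protected) xs-unique
    (subst (4 ≤_) (sym length-V) 4≤m)
    (subst (λ l → l % 3 ≡ 1 ⊎ l % 3 ≡ 2) (sym length-V) mod)
    (edgesOf-tabulate-unique protected protected-disjoint) ∈-edgesOf-protected

  D : List Path₄
  D = tabulate protected ++ proj₁ decomposition

  target : DesignOfOrder (P 4) (2 + m)
  target = record
    { host   = completeOn xs
    ; host≅K = completeOn≅K (2 + m) g g⁻¹ g⁻¹-g
    ; design = decomposition⇒design xs-unique P₄≤completeOn D (proj₂ decomposition)
    }

  protected∈D : ∀ i → protected i ∈ D
  protected∈D i = ∈-++⁺ˡ (∈-tabulate⁺ i)

  P₄≤Pₖ : P 4 ≤ᴳ P k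
  P₄≤Pₖ = P 4 , ((λ x∈ → ∈-upTo⁺ (4≤ (∈-upTo⁻ x∈))) , λ (x<4 , y<4 , e) → 4≤ x<4 , 4≤ y<4 , e) , record
    { to = id ; from = id ; to-∈ = id ; from-∈ = id
    ; from∘to = λ _ → refl ; to∘from = λ _ → refl ; adj-⇔ = λ _ _ → mk⇔ id id }
    where
    4≤ : ∀ {x} → x < 4 → x < k
    4≤ x<4 = <-≤-trans x<4 (≤-trans (m≤m+n 4 8) 12≤k)

  downLink : DownLinkedTo B target
  downLink = record
    { Γ′≤Γ     = P₄≤Pₖ
    -- Block i is sent to a place where its own protected path stands in D.
    ; f        = λ i → Any.index (protected∈D i)
    ; subgraph = λ i → subst (λ p → pathGraph p ⊑ block i) (lookup-index (protected∈D i)) (protected⊑block i)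
    }

theorem4p2 : (k v : ℕ) → 12 ≤ k → Admissible (P k) v →
    ((λ n → (v ∸ (k ∸ 12) / 4 ≤ n) × (n % 3 ≡ 0 ⊎ n % 3 ≡ 1)) ⊆ ℒ₂ (P k) v)
    × (ℒ₂ (P k) v ⊆ ℒ₁ (P k) v)
-- The second inclusion holds because admissibility provides a design A to which the property of all
-- designs can be applied.
theorem4p2 k v 12≤k A = linked _ , λ link → A , link A
  where
  s = (k ∸ 12) / 4
  linked : ∀ n → (v ∸ s ≤ n) × (n % 3 ≡ 0 ⊎ n % 3 ≡ 1) → ℒ₂ (P k) v n
  linked n (v∸s≤n , mod) B = go n 6≤n v≤ mod
    where
    v≤ : v ≤ n + s
    v≤ = ≤-trans (m≤n+m∸n v s) (≤-trans (+-monoʳ-≤ s v∸s≤n) (≤-reflexive (+-comm s n)))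
    -- With n = 2 + m this is the condition 4 ≤ m under which the construction works; it follows
    -- from n + s ≥ v ≥ k ≥ 12 + 4s.
    6≤n : 6 ≤ n
    6≤n = +-cancelʳ-≤ s 6 n (begin
      6 + s       ≤⟨ +-mono-≤ (m≤m+n 6 6) (m≤m*n s 4) ⟩
      12 + s * 4  ≤⟨ 12+[k∸12]/4*4≤k 12≤k ⟩
      k           ≤⟨ P≤ᴳ⇒≤ (DesignOfOrder.Γ≤G B) (DesignOfOrder.host≅K B) ⟩
      v           ≤⟨ v≤ ⟩
      n + s       ∎)
      where open ≤-Reasoning
    go : ∀ n → 6 ≤ n → v ≤ n + s → n % 3 ≡ 0 ⊎ n % 3 ≡ 1 → Σ (DesignOfOrder (P 4) n) (DownLinkedTo B)
    go (suc (suc m)) (s≤s (s≤s 4≤m)) v≤ mod = target , downLink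
      where open DownLinking k v m 12≤k 4≤m B v≤ (order-mod-3 m mod)
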